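{- Let $A,B\in\mathbb{Q}$ with $AB\neq 0$. The trinomial $x^4+Ax+B$ has reducibility type $(1,1,2)$ if and only if, up to scaling, $$A=-(u+1)(u^2+1),\qquad B=u(u^2+u+1)$$ for some $u\in\mathbb{Q}\setminus\{0,-1\}$, in which case the factorization is $$x^4+Ax+B=(x-1)(x-u)\bigl(x^2+(u+1)x+(u^2+u+1)\bigr).$$ Moreover, there are no trinomials $x^4+Ax+B$ with $A,B\in\mathbb{Q}$, $AB\ne0$, of reducibility type $(1,1,1,1)$.
   Context: A monic polynomial in $\mathbb{Q}[x]$ has reducibility type $(n_1,\dots,n_k)$, $n_1\le\dots\le n_k$, if it factors as a product of $k$ irreducible polynomials in $\mathbb{Q}[x]$ (not necessarily distinct) of degrees $n_1,\dots,n_k$. Trinomials are considered up to scaling: $x^n+Ax^m+B$ and $x^n+A\lambda^{n-m}x^m+B\lambda^n$ are identified for $\lambda\in\mathbb{Q}\setminus\{0\}$; "up to scaling $(A,B)=(A_0,B_0)$" means $(A,B)=(A_0\lambda^{n-m},B_0\lambda^n)$ for some $\lambda\in\mathbb{Q}\setminus\{0\}$ (and the factorization is that of the scaled trinomial). -}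

module Defs where

open import Algebra.Bundles.Raw using (RawRing)
import Algebra.Definitions.RawSemiring as RawSemiringDefinitions
open import Data.List.Base using (List; []; _∷_; map; foldr)
open import Data.List.Relation.Binary.Pointwise using (Pointwise)
open import Data.List.Relation.Unary.All using (All)
import Data.List.Relation.Unary.Sorted.TotalOrder as SortedTotalOrder
open import Data.Nat.Base as ℕ using (ℕ; zero; suc)
import Data.Nat.Properties as ℕ
open import Data.Product.Base using (_×_; _,_; ∃-syntax)
open import Data.Rational.Base as ℚ using (ℚ; 0ℚ; 1ℚ)
open import Level using (0ℓ)
open import Relation.Binary.PropositionalEquality.Core using (_≡_; _≢_)

open SortedTotalOrder ℕ.≤-totalOrder using (Sorted)

open RawSemiringDefinitions ℚ.+-*-rawSemiring public using (_^_)

-- The list a₀ ∷ a₁ ∷ … ∷ [] represents a₀ + a₁ x + ….  Trailing zeros are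
-- allowed, so equality of polynomials is _≈_ below, not _≡_.
Poly : Set
Poly = List ℚ

coeff : Poly → ℕ → ℚ
coeff []      _       = 0ℚ
coeff (a ∷ p) zero    = a
coeff (a ∷ p) (suc n) = coeff p n

infix  4 _≈_
infix  8 -ᴾ_
infixl 7 _*ᴾ_
infixl 6 _+ᴾ_ _-ᴾ_

-- A record rather than a plain function type so that p and q can be inferred
-- from a proof of p ≈ q.
record _≈_ (p q : Poly) : Set where
  constructor mk≈
  field
    coeff-≡ : ∀ n → coeff p n ≡ coeff q n

open _≈_ public

C : ℚ → Poly
C a = a ∷ []

X : Poly
X = 0ℚ ∷ 1ℚ ∷ []

_+ᴾ_ : Poly → Poly → Poly
[]      +ᴾ q       = q
(a ∷ p) +ᴾ []      = a ∷ p
(a ∷ p) +ᴾ (b ∷ q) = (a ℚ.+ b) ∷ (p +ᴾ q)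

-ᴾ_ : Poly → Poly
-ᴾ p = map ℚ.-_ p

_-ᴾ_ : Poly → Poly → Poly
p -ᴾ q = p +ᴾ (-ᴾ q)

-- (a + x p) q = a q + x (p q)
_*ᴾ_ : Poly → Poly → Poly
[]      *ᴾ q = []
(a ∷ p) *ᴾ q = map (a ℚ.*_) q +ᴾ (0ℚ ∷ (p *ᴾ q))

polyRawRing : RawRing 0ℓ 0ℓ
polyRawRing = record
  { Carrier = Poly
  ; _≈_     = _≈_
  ; _+_     = _+ᴾ_
  ; _*_     = _*ᴾ_
  ; -_      = -ᴾ_
  ; 0#      = []
  ; 1#      = C 1ℚ
  }

-- The library's Irreducible p says that p is not a unit and that p ≈ q *ᴾ r
-- forces q or r to be a unit (a divisor of 1).  It excludes 0, as 0 = 0 · 0.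
open RawSemiringDefinitions (RawRing.rawSemiring polyRawRing) public
  using (Irreducible)
  renaming (_^_ to infixr 8 _^ᴾ_)

HasDegree : Poly → ℕ → Set
HasDegree p n = coeff p n ≢ 0ℚ × (∀ m → n ℕ.< m → coeff p m ≡ 0ℚ)

Monic : Poly → Set
Monic p = ∃[ n ] (HasDegree p n × coeff p n ≡ 1ℚ)

record IrreducibleFactorization (p : Poly) (fs : List Poly) : Set where
  field
    irreducible : All Irreducible fs
    factors     : p ≈ foldr _*ᴾ_ (C 1ℚ) fs

record HasReducibilityType (p : Poly) (ns : List ℕ) : Set where
  field
    monic         : Monic p
    sorted        : Sorted ns
    fs            : List Poly
    factorization : IrreducibleFactorization p fs
    degrees       : Pointwise HasDegree fs ns

trinomial : ℕ → ℕ → ℚ → ℚ → Poly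
trinomial n m A B = X ^ᴾ n +ᴾ C A *ᴾ X ^ᴾ m +ᴾ C B

-- Up to scaling (A , B) = (A₀ , B₀), for trinomials xⁿ + A xᵐ + B with m ≤ n
-- (so that the truncated subtraction is the actual one).
UpToScaling : (n m : ℕ) → ℚ × ℚ → ℚ × ℚ → Set
UpToScaling n m (A , B) (A₀ , B₀) =
  ∃[ t ] (t ≢ 0ℚ × A ≡ A₀ ℚ.* t ^ (n ℕ.∸ m) × B ≡ B₀ ℚ.* t ^ n)

{-# OPTIONS --safe #-}
-- If x⁴ + Ax + B has roots r and s, then comparing coefficients makes the
-- remaining quadratic factor x² + (r+s)x + (r²+rs+s²); with t = r and
-- u = s/r this is the asserted parametrization.  Conversely the discriminant
-- of that quadratic is -(2r² + 2s² + (r+s)²) < 0, so it is irreducible.  Four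
-- rational roots would have e₁ = e₂ = 0, so their squares would sum to 0.
module Submission where

open import Defs
open import Algebra.Bundles.Raw using (module RawRing)
import Algebra.Definitions.RawSemiring as RawSemiringDefinitions
open import Data.Empty using (⊥-elim)
open import Data.Integer.Base as ℤ using ()
open import Data.List.Base using (List; []; _∷_; map; foldr; applyUpTo)
open import Data.List.Relation.Binary.Pointwise using ([]; _∷_)
open import Data.List.Relation.Unary.All using ([]; _∷_)
open import Data.List.Relation.Unary.Linked using ([-]; _∷_)
open import Data.Nat.Base as ℕ using (ℕ; zero; suc; z≤n; s≤s)
import Data.Nat.Properties as ℕ
open import Data.Product.Base using (_×_; _,_; ∃-syntax)
open import Data.Rational.Base using
  (ℚ; 0ℚ; 1ℚ; _+_; _*_; -_; _/_; 1/_; NonNegative; NonZero; ≢-nonZero; nonNegative; nonPositive)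
open import Data.Rational.Properties using
  ( _≟_; ≤-total; *-assoc; *-identityˡ; *-identityʳ; *-inverseˡ; *-zeroˡ; *-zeroʳ
  ; +-identityˡ; +-identityʳ; nonNeg*nonNeg⇒nonNeg; nonPos*nonPos⇒nonPos
  ; nonNeg+nonNeg⇒nonNeg; nonNeg∧nonZero⇒pos; pos+nonNeg⇒pos; pos⇒nonZero )
open import Data.Rational.Solver using (module +-*-Solver)
open import Data.Sum.Base using (_⊎_; inj₁; inj₂)
open import Function.Base using (_∘_)
open import Function.Bundles using (_⇔_; mk⇔)
open import Relation.Binary.Definitions using (tri<; tri≈; tri>)
open import Relation.Binary.PropositionalEquality.Core using (_≡_; _≢_; refl; sym; trans; cong; cong₂; subst)
open import Relation.Nullary.Decidable.Core using (yes; no)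
open import Relation.Nullary.Negation.Core using (¬_)

open +-*-Solver using (Polynomial; solve; _:=_; _:+_; _:*_; :-_; con)
open RawSemiringDefinitions (RawRing.rawSemiring polyRawRing) using (_∣_; _∤_; module Irreducible)

-- Rational numbers

4ℚ : ℚ
4ℚ = ℤ.+ 4 / 1

x*y≡0⇒y≡0 : ∀ {x y} → x ≢ 0ℚ → x * y ≡ 0ℚ → y ≡ 0ℚ
x*y≡0⇒y≡0 {x} {y} x≢0 xy≡0 =
  trans (sym (*-identityˡ y))
  (trans (cong (_* y) (sym (*-inverseˡ x)))
  (trans (*-assoc (1/ x) x y)
  (trans (cong (1/ x *_) xy≡0) (*-zeroʳ (1/ x)))))
  where instance _ = ≢-nonZero x≢0

*-≢0 : ∀ {x y} → x ≢ 0ℚ → y ≢ 0ℚ → x * y ≢ 0ℚ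
*-≢0 x≢0 y≢0 = y≢0 ∘ x*y≡0⇒y≡0 x≢0

*-≢0⇒ˡ : ∀ x y → x * y ≢ 0ℚ → x ≢ 0ℚ
*-≢0⇒ˡ _ y xy≢0 refl = xy≢0 (*-zeroˡ y)

*-≢0⇒ʳ : ∀ x y → x * y ≢ 0ℚ → y ≢ 0ℚ
*-≢0⇒ʳ x _ xy≢0 refl = xy≢0 (*-zeroʳ x)

square-nonNeg : ∀ x → NonNegative (x * x)
square-nonNeg x with ≤-total 0ℚ x
... | inj₁ 0≤x = nonNeg*nonNeg⇒nonNeg x {{nonNegative 0≤x}} x {{nonNegative 0≤x}}
... | inj₂ x≤0 = nonPos*nonPos⇒nonPos x {{nonPositive x≤0}} x {{nonPositive x≤0}}

sumOfSquares : List ℚ → ℚ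
sumOfSquares = foldr (λ x s → x * x + s) 0ℚ

sumOfSquares-nonNeg : ∀ xs → NonNegative (sumOfSquares xs)
sumOfSquares-nonNeg []       = _
sumOfSquares-nonNeg (x ∷ xs) =
  nonNeg+nonNeg⇒nonNeg (x * x) {{square-nonNeg x}} (sumOfSquares xs) {{sumOfSquares-nonNeg xs}}

-- A nonzero head makes the sum positive. Only the head is shown to vanish, so callers list the
-- quantity of interest first.
sumOfSquares≡0 : ∀ x xs → sumOfSquares (x ∷ xs) ≡ 0ℚ → x ≡ 0ℚ
sumOfSquares≡0 x xs eq with x ≟ 0ℚ
... | yes x≡0 = x≡0
-- `NonZero 0ℚ` unfolds to a record whose only field is a proof of falsity.
... | no x≢0 = ⊥-elim (ℕ.NonZero.nonZero (subst NonZero eq (pos⇒nonZero (sumOfSquares (x ∷ xs)) {{sum>0}})))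
  where
  x²>0 = nonNeg∧nonZero⇒pos (x * x) {{square-nonNeg x}} {{≢-nonZero (*-≢0 x≢0 x≢0)}}
  sum>0 = pos+nonNeg⇒pos (x * x) {{x²>0}} (sumOfSquares xs) {{sumOfSquares-nonNeg xs}}

0+0≡0 : ∀ {x y} → x ≡ 0ℚ → y ≡ 0ℚ → x + y ≡ 0ℚ
0+0≡0 refl refl = refl

x*0≡0 : ∀ x {y} → y ≡ 0ℚ → x * y ≡ 0ℚ
x*0≡0 x refl = *-zeroʳ x

-- Coefficients of products

-- Degree at most n, for a coefficient sequence that may be zero.
VanishesBeyond : (ℕ → ℚ) → ℕ → Set
VanishesBeyond f n = ∀ i → n ℕ.< i → f i ≡ 0ℚ

-- The Cauchy product. It recurses by shifting the left factor, as `_*ᴾ_` does, but on functions,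
-- where trailing zeros make no difference.
conv : (ℕ → ℚ) → (ℕ → ℚ) → ℕ → ℚ
conv f g zero    = f 0 * g 0
conv f g (suc n) = f 0 * g (suc n) + conv (f ∘ suc) g n

conv-cong : ∀ {f f′ g g′} → (∀ i → f i ≡ f′ i) → (∀ i → g i ≡ g′ i) →
            ∀ n → conv f g n ≡ conv f′ g′ n
conv-cong f≗f′ g≗g′ zero    = cong₂ _*_ (f≗f′ 0) (g≗g′ 0)
conv-cong f≗f′ g≗g′ (suc n) =
  cong₂ _+_ (cong₂ _*_ (f≗f′ 0) (g≗g′ (suc n))) (conv-cong (f≗f′ ∘ suc) g≗g′ n)

conv-zeroˡ : ∀ f g → (∀ i → f i ≡ 0ℚ) → ∀ n → conv f g n ≡ 0ℚ
conv-zeroˡ f g f≗0 zero    = trans (cong (_* g 0) (f≗0 0)) (*-zeroˡ (g 0))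
conv-zeroˡ f g f≗0 (suc n) =
  0+0≡0 (trans (cong (_* g (suc n)) (f≗0 0)) (*-zeroˡ (g (suc n))))
        (conv-zeroˡ (f ∘ suc) g (f≗0 ∘ suc) n)

conv-constˡ : ∀ f g → VanishesBeyond f 0 → ∀ n → conv f g n ≡ f 0 * g n
conv-constˡ f g f0 zero    = refl
conv-constˡ f g f0 (suc n) =
  trans (cong (f 0 * g (suc n) +_) (conv-zeroˡ (f ∘ suc) g (λ i → f0 (suc i) (s≤s z≤n)) n))
        (+-identityʳ (f 0 * g (suc n)))

-- Induction on m: the term split off is `f 0` times a coefficient of g beyond n, hence zero, and
-- the rest is the same claim for the shifted f.
conv-top : ∀ f g m n → VanishesBeyond f m → VanishesBeyond g n →
           conv f g (m ℕ.+ n) ≡ f m * g n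
conv-top f g zero    n f0 g0 = conv-constˡ f g f0 n
conv-top f g (suc m) n f0 g0 =
  trans (cong₂ _+_ (x*0≡0 (f 0) (g0 (suc (m ℕ.+ n)) (s≤s (ℕ.m≤n+m n m))))
                   (conv-top (f ∘ suc) g m n (λ i → f0 (suc i) ∘ s≤s) g0))
        (+-identityˡ _)

conv-beyond : ∀ f g m n → VanishesBeyond f m → VanishesBeyond g n →
              VanishesBeyond (conv f g) (m ℕ.+ n)
conv-beyond f g zero    n f0 g0 k n<k =
  trans (conv-constˡ f g f0 k) (x*0≡0 (f 0) (g0 k n<k))
conv-beyond f g (suc m) n f0 g0 (suc k) (s≤s m+n<k) =
  0+0≡0 (x*0≡0 (f 0) (g0 (suc k) (s≤s (ℕ.≤-trans (ℕ.m≤n+m n m) (ℕ.<⇒≤ m+n<k)))))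
        (conv-beyond (f ∘ suc) g m n (λ i → f0 (suc i) ∘ s≤s) g0 k m+n<k)

coeff-+ᴾ : ∀ p q n → coeff (p +ᴾ q) n ≡ coeff p n + coeff q n
coeff-+ᴾ []      q       n       = sym (+-identityˡ (coeff q n))
coeff-+ᴾ (a ∷ p) []      n       = sym (+-identityʳ (coeff (a ∷ p) n))
coeff-+ᴾ (a ∷ p) (b ∷ q) zero    = refl
coeff-+ᴾ (a ∷ p) (b ∷ q) (suc n) = coeff-+ᴾ p q n

coeff-map-* : ∀ a q n → coeff (map (a *_) q) n ≡ a * coeff q n
coeff-map-* a []      n       = sym (*-zeroʳ a)
coeff-map-* a (b ∷ q) zero    = refl
coeff-map-* a (b ∷ q) (suc n) = coeff-map-* a q n

-- Products depend on their factors only through coefficients; this is why `_*ᴾ_` respects `_≈_` and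
-- why degrees can be computed with `conv`.
coeff-*ᴾ : ∀ p q n → coeff (p *ᴾ q) n ≡ conv (coeff p) (coeff q) n
coeff-*ᴾ []      q n       = sym (conv-zeroˡ (coeff []) (coeff q) (λ _ → refl) n)
coeff-*ᴾ (a ∷ p) q zero    =
  trans (coeff-+ᴾ (map (a *_) q) (0ℚ ∷ p *ᴾ q) 0)
  (trans (+-identityʳ _) (coeff-map-* a q 0))
coeff-*ᴾ (a ∷ p) q (suc n) =
  trans (coeff-+ᴾ (map (a *_) q) (0ℚ ∷ p *ᴾ q) (suc n))
        (cong₂ _+_ (coeff-map-* a q (suc n)) (coeff-*ᴾ p q n))

≈-refl : ∀ {p} → p ≈ p
≈-refl = mk≈ λ _ → refl

≈-sym : ∀ {p q} → p ≈ q → q ≈ p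
≈-sym e = mk≈ λ n → sym (coeff-≡ e n)

≈-trans : ∀ {p q r} → p ≈ q → q ≈ r → p ≈ r
≈-trans e e′ = mk≈ λ n → trans (coeff-≡ e n) (coeff-≡ e′ n)

*ᴾ-cong : ∀ {p p′ q q′} → p ≈ p′ → q ≈ q′ → p *ᴾ q ≈ p′ *ᴾ q′
*ᴾ-cong {p} {p′} {q} {q′} e e′ = mk≈ λ n →
  trans (coeff-*ᴾ p q n)
  (trans (conv-cong (coeff-≡ e) (coeff-≡ e′) n) (sym (coeff-*ᴾ p′ q′ n)))

*ᴾ-identityʳ : ∀ p → p *ᴾ C 1ℚ ≈ p
*ᴾ-identityʳ p = mk≈ λ n → trans (coeff-*ᴾ p (C 1ℚ) n) (conv-identityʳ (coeff p) n)
  where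
  conv-identityʳ : ∀ f n → conv f (coeff (C 1ℚ)) n ≡ f n
  conv-identityʳ f zero    = *-identityʳ (f 0)
  conv-identityʳ f (suc n) =
    trans (cong₂ _+_ (*-zeroʳ (f 0)) (conv-identityʳ (f ∘ suc) n)) (+-identityˡ (f (suc n)))

-- Coefficients of (a + bX) g with at most two terms each, so that nested products of linear factors
-- unfold to expressions fit for the ring solver.
timesLinear : ℚ → ℚ → (ℕ → ℚ) → ℕ → ℚ
timesLinear a b g zero    = a * g zero
timesLinear a b g (suc n) = a * g (suc n) + b * g n

timesLinear-cong : ∀ a b {g h} → (∀ n → g n ≡ h n) → ∀ n → timesLinear a b g n ≡ timesLinear a b h n
timesLinear-cong a b g≗h zero    = cong (a *_) (g≗h 0)
timesLinear-cong a b g≗h (suc n) = cong₂ _+_ (cong (a *_) (g≗h (suc n))) (cong (b *_) (g≗h n))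

coeff-linear-*ᴾ : ∀ a b q n → coeff ((a ∷ b ∷ []) *ᴾ q) n ≡ timesLinear a b (coeff q) n
coeff-linear-*ᴾ a b q zero    = coeff-*ᴾ (a ∷ b ∷ []) q 0
coeff-linear-*ᴾ a b q (suc n) =
  trans (coeff-*ᴾ (a ∷ b ∷ []) q (suc n))
        (cong (a * coeff q (suc n) +_) (conv-constˡ _ (coeff q) (λ { (suc _) _ → refl }) n))

coeff-linear²-*ᴾ : ∀ a b a′ b′ q n → coeff ((a ∷ b ∷ []) *ᴾ ((a′ ∷ b′ ∷ []) *ᴾ q)) n ≡
                   timesLinear a b (timesLinear a′ b′ (coeff q)) n
coeff-linear²-*ᴾ a b a′ b′ q n =
  trans (coeff-linear-*ᴾ a b ((a′ ∷ b′ ∷ []) *ᴾ q) n) (timesLinear-cong a b (coeff-linear-*ᴾ a′ b′ q) n)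

-- Degrees

HasDegree-resp-≈ : ∀ {p q n} → p ≈ q → HasDegree p n → HasDegree q n
HasDegree-resp-≈ {n = n} e (lead , beyond) =
  (λ q≡0 → lead (trans (coeff-≡ e n) q≡0)) , λ m n<m → trans (sym (coeff-≡ e m)) (beyond m n<m)

HasDegree-unique : ∀ p {m n} → HasDegree p m → HasDegree p n → m ≡ n
HasDegree-unique p {m} {n} (lead , beyond) (lead′ , beyond′) with ℕ.<-cmp m n
... | tri< m<n _ _ = ⊥-elim (lead′ (beyond n m<n))
... | tri≈ _ m≡n _ = m≡n
... | tri> _ _ n<m = ⊥-elim (lead (beyond′ m n<m))

HasDegree-*ᴾ : ∀ p q {m n} → HasDegree p m → HasDegree q n → HasDegree (p *ᴾ q) (m ℕ.+ n)
HasDegree-*ᴾ p q {m} {n} (lead , beyond) (lead′ , beyond′) =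
  (λ pq≡0 → *-≢0 lead lead′
    (trans (sym (conv-top (coeff p) (coeff q) m n beyond beyond′))
    (trans (sym (coeff-*ᴾ p q (m ℕ.+ n))) pq≡0))) ,
  λ k k> → trans (coeff-*ᴾ p q k) (conv-beyond (coeff p) (coeff q) m n beyond beyond′ k k>)

HasDegree-linear : ∀ {a b} → b ≢ 0ℚ → HasDegree (a ∷ b ∷ []) 1
HasDegree-linear b≢0 = b≢0 , λ { (suc (suc _)) _ → refl ; (suc zero) (s≤s ()) }

HasDegree-quadratic : ∀ {a b c} → c ≢ 0ℚ → HasDegree (a ∷ b ∷ c ∷ []) 2
HasDegree-quadratic c≢0 =
  c≢0 , λ { (suc (suc (suc _))) _ → refl ; (suc zero) (s≤s ()) ; (suc (suc zero)) (s≤s (s≤s ())) }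

-- Trailing zeros hide the degree, so the tail is decided first and the head matters only when the
-- tail is zero.
zero-or-degree : ∀ p → p ≈ [] ⊎ (∃[ n ] HasDegree p n)
zero-or-degree [] = inj₁ (mk≈ λ _ → refl)
zero-or-degree (a ∷ p) with zero-or-degree p
... | inj₂ (n , lead , beyond) =
  inj₂ (suc n , lead , λ { (suc m) (s≤s n<m) → beyond m n<m })
... | inj₁ p≈0 with a ≟ 0ℚ
...   | yes a≡0 = inj₁ (mk≈ λ { zero → a≡0 ; (suc n) → coeff-≡ p≈0 n })
...   | no a≢0 = inj₂ (0 , a≢0 , λ { (suc m) _ → coeff-≡ p≈0 m })

-- Strips trailing zeros: a factor of known degree becomes an explicit list of its coefficients.
applyUpTo-coeff : ∀ p {n} → HasDegree p n → p ≈ applyUpTo (coeff p) (suc n)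
applyUpTo-coeff p {n} (_ , beyond) = mk≈ (applyUpTo-≗ (coeff p) (suc n) beyond)
  where
  applyUpTo-≗ : ∀ f n → (∀ i → n ℕ.≤ i → f i ≡ 0ℚ) → ∀ i → f i ≡ coeff (applyUpTo f n) i
  applyUpTo-≗ f zero    f0 i       = f0 i z≤n
  applyUpTo-≗ f (suc n) f0 zero    = refl
  applyUpTo-≗ f (suc n) f0 (suc i) = applyUpTo-≗ (f ∘ suc) n (λ j → f0 (suc j) ∘ s≤s) i

*ᴾ-zeroˡ : ∀ {p} q → p ≈ [] → p *ᴾ q ≈ []
*ᴾ-zeroˡ {p} q p≈0 = mk≈ λ n → trans (coeff-*ᴾ p q n) (conv-zeroˡ (coeff p) (coeff q) (coeff-≡ p≈0) n)

*ᴾ-zeroʳ : ∀ p {q} → q ≈ [] → p *ᴾ q ≈ []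
*ᴾ-zeroʳ []      q≈0 = mk≈ λ _ → refl
*ᴾ-zeroʳ (a ∷ p) {q} q≈0 = mk≈ λ n →
  trans (coeff-+ᴾ (map (a *_) q) (0ℚ ∷ p *ᴾ q) n)
  (0+0≡0 (trans (coeff-map-* a q n) (x*0≡0 a (coeff-≡ q≈0 n)))
         (shifted n))
  where
  shifted : ∀ n → coeff (0ℚ ∷ p *ᴾ q) n ≡ 0ℚ
  shifted zero    = refl
  shifted (suc n) = coeff-≡ (*ᴾ-zeroʳ p q≈0) n

-- A zero factor would kill the leading coefficient of p. Hence both factors have degrees, which add
-- up to the unique degree of p.
factor-degrees : ∀ {p k} x y → HasDegree p k → p ≈ x *ᴾ y →
                 ∃[ m ] ∃[ n ] (HasDegree x m × HasDegree y n × m ℕ.+ n ≡ k)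
factor-degrees {k = k} x y (lead , beyond) e with zero-or-degree x | zero-or-degree y
... | inj₁ x≈0 | _ = ⊥-elim (lead (coeff-≡ (≈-trans e (*ᴾ-zeroˡ y x≈0)) k))
... | inj₂ _ | inj₁ y≈0 = ⊥-elim (lead (coeff-≡ (≈-trans e (*ᴾ-zeroʳ x y≈0)) k))
... | inj₂ (m , dx) | inj₂ (n , dy) =
  m , n , dx , dy , HasDegree-unique (x *ᴾ y) (HasDegree-*ᴾ x y dx dy) (HasDegree-resp-≈ e (lead , beyond))

-- Irreducibility

-- The cofactor is the inverse of the constant term; the higher coefficients are checked because p
-- may carry trailing zeros.
degree-0⇒∣1 : ∀ p → HasDegree p 0 → p ∣ C 1ℚ
degree-0⇒∣1 p (lead , beyond) = record { quotient = C (1/ coeff p 0) ; equality = mk≈ eq }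
  where
  instance _ = ≢-nonZero lead
  product : ∀ n → coeff (C (1/ coeff p 0) *ᴾ p) n ≡ 1/ coeff p 0 * coeff p n
  product n = trans (coeff-*ᴾ (C (1/ coeff p 0)) p n)
                    (conv-constˡ (coeff (C (1/ coeff p 0))) (coeff p) (λ { (suc _) _ → refl }) n)
  eq : ∀ n → coeff (C (1/ coeff p 0) *ᴾ p) n ≡ coeff (C 1ℚ) n
  eq zero    = trans (product 0) (*-inverseˡ (coeff p 0))
  eq (suc n) = trans (product (suc n)) (x*0≡0 (1/ coeff p 0) (beyond (suc n) (s≤s z≤n)))

degree-suc⇒∤1 : ∀ {p n} → HasDegree p (suc n) → p ∤ C 1ℚ
degree-suc⇒∤1 {p} {n} d record { quotient = q ; equality = e }
  -- The pair says that `C 1ℚ` has degree 0, so a divisor of it has degree 0 too.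
  with factor-degrees q p ((λ ()) , λ { (suc _) _ → refl }) (≈-sym e)
... | m , k , _ , d′ , m+k≡0 with HasDegree-unique p d d′ | ℕ.m+n≡0⇒n≡0 m m+k≡0
...   | refl | ()

Irreducible-resp-≈ : ∀ {p q} → p ≈ q → Irreducible p → Irreducible q
Irreducible-resp-≈ p≈q irr = record
  { p∤1 = λ { record { quotient = r ; equality = e } →
      Irreducible.p∤1 irr (record { quotient = r ; equality = ≈-trans (*ᴾ-cong (≈-refl {r}) p≈q) e }) }
  ; split-∣1 = λ e → Irreducible.split-∣1 irr (≈-trans p≈q e)
  }

-- Since 1 is only 0 + 1 or 1 + 0, one of the factors is a nonzero constant.
linear-irreducible : ∀ {p} → HasDegree p 1 → Irreducible p
linear-irreducible {p} d = record { p∤1 = degree-suc⇒∤1 d ; split-∣1 = split }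
  where
  split : ∀ {x y} → p ≈ x *ᴾ y → x ∣ C 1ℚ ⊎ y ∣ C 1ℚ
  split {x} {y} e with factor-degrees x y d e
  ... | zero  , _    , dx , _  , _    = inj₁ (degree-0⇒∣1 x dx)
  ... | suc _ , zero , _  , dy , _    = inj₂ (degree-0⇒∣1 y dy)
  ... | suc m , suc n , _ , _  , eq with trans (sym (ℕ.+-suc m n)) (ℕ.suc-injective eq)
  ...   | ()

-- A factorization (x₀ + x₁X)(y₀ + y₁X) has discriminant (x₀y₁ - x₁y₀)².
quadratic-irreducible : ∀ {p} → HasDegree p 2 →
  (∀ w → w * w ≢ coeff p 1 * coeff p 1 + - (4ℚ * (coeff p 0 * coeff p 2))) → Irreducible p
quadratic-irreducible {p} d disc-nonsquare = record { p∤1 = degree-suc⇒∤1 d ; split-∣1 = split }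
  where
  split : ∀ {x y} → p ≈ x *ᴾ y → x ∣ C 1ℚ ⊎ y ∣ C 1ℚ
  split {x} {y} e with factor-degrees x y d e
  ... | zero        , _    , dx , _  , _    = inj₁ (degree-0⇒∣1 x dx)
  ... | suc _       , zero , _  , dy , _    = inj₂ (degree-0⇒∣1 y dy)
  ... | suc (suc m) , suc n , _ , _  , eq
    with trans (sym (ℕ.+-suc m n)) (ℕ.suc-injective (ℕ.suc-injective eq))
  ...   | ()
  split {x} {y} e | suc zero , suc (suc _) , _ , _ , ()
  split {x} {y} e | suc zero , suc zero , (_ , x0) , (_ , y0) , refl =
    ⊥-elim (disc-nonsquare (x₀ * y₁ + - (x₁ * y₀))
      (trans (square x₀ x₁ y₀ y₁)
             (sym (cong₂ (λ s t → s * s + - (4ℚ * t)) p₁ (cong₂ _*_ p₀ p₂)))))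
    where
    x₀ = coeff x 0
    x₁ = coeff x 1
    y₀ = coeff y 0
    y₁ = coeff y 1
    p₀ : coeff p 0 ≡ x₀ * y₀
    p₀ = trans (coeff-≡ e 0) (coeff-*ᴾ x y 0)
    p₁ : coeff p 1 ≡ x₀ * y₁ + x₁ * y₀
    p₁ = trans (coeff-≡ e 1) (coeff-*ᴾ x y 1)
    -- The terms x₀y₂ and x₂y₀ of the convolution vanish because both factors have degree 1.
    p₂ : coeff p 2 ≡ x₁ * y₁
    p₂ = trans (coeff-≡ e 2) (trans (coeff-*ᴾ x y 2) (conv-top (coeff x) (coeff y) 1 1 x0 y0))
    square : ∀ x₀ x₁ y₀ y₁ → (x₀ * y₁ + - (x₁ * y₀)) * (x₀ * y₁ + - (x₁ * y₀)) ≡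
             (x₀ * y₁ + x₁ * y₀) * (x₀ * y₁ + x₁ * y₀) + - (4ℚ * ((x₀ * y₀) * (x₁ * y₁)))
    square = solve 4 (λ x₀ x₁ y₀ y₁ →
      (x₀ :* y₁ :+ :- (x₁ :* y₀)) :* (x₀ :* y₁ :+ :- (x₁ :* y₀)) :=
      (x₀ :* y₁ :+ x₁ :* y₀) :* (x₀ :* y₁ :+ x₁ :* y₀) :+ :- (con 4ℚ :* ((x₀ :* y₀) :* (x₁ :* y₁)))) refl

-- Trinomials x⁴ + Ax + B

trinomial-coeffs : ∀ A B → trinomial 4 1 A B ≈ B ∷ A ∷ 0ℚ ∷ 0ℚ ∷ 1ℚ ∷ []
coeff-≡ (trinomial-coeffs A B) 0 =
  solve 2 (λ A B → (con 0ℚ :+ (A :* con 0ℚ :+ con 0ℚ)) :+ B := B) refl A B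
coeff-≡ (trinomial-coeffs A B) 1 = solve 1 (λ A → con 0ℚ :+ A :* con 1ℚ := A) refl A
coeff-≡ (trinomial-coeffs A B) 2 = refl
coeff-≡ (trinomial-coeffs A B) 3 = refl
coeff-≡ (trinomial-coeffs A B) 4 = refl
coeff-≡ (trinomial-coeffs A B) (suc (suc (suc (suc (suc n))))) = refl

trinomial-monic : ∀ A B → Monic (trinomial 4 1 A B)
trinomial-monic A B = 4 , HasDegree-resp-≈ (≈-sym (trinomial-coeffs A B)) degree , refl
  where
  degree : HasDegree (B ∷ A ∷ 0ℚ ∷ 0ℚ ∷ 1ℚ ∷ []) 4
  degree = (λ ()) , λ { (suc (suc (suc (suc (suc _))))) _ → refl
                      ; 1 (s≤s ())
                      ; 2 (s≤s (s≤s ()))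
                      ; 3 (s≤s (s≤s (s≤s ())))
                      ; 4 (s≤s (s≤s (s≤s (s≤s ())))) }

-- timesLinear and coeff on expressions of the ring solver
timesLinearₛ : ∀ {k} → Polynomial k → Polynomial k → (ℕ → Polynomial k) → ℕ → Polynomial k
timesLinearₛ a b g zero    = a :* g zero
timesLinearₛ a b g (suc n) = a :* g (suc n) :+ b :* g n

coeffₛ : ∀ {k} → List (Polynomial k) → ℕ → Polynomial k
coeffₛ []      _       = con 0ℚ
coeffₛ (a ∷ p) zero    = a
coeffₛ (a ∷ p) (suc n) = coeffₛ p n

-- The product (a + bX)(a′ + b′X)(d + cX + eX²).
splitCoeffs : (a b a′ b′ d c e : ℚ) → ℕ → ℚ
splitCoeffs a b a′ b′ d c e = timesLinear a b (timesLinear a′ b′ (coeff (d ∷ c ∷ e ∷ [])))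

splitCoeffsₛ : ∀ {k} (a b a′ b′ d c e : Polynomial k) → ℕ → Polynomial k
splitCoeffsₛ a b a′ b′ d c e = timesLinearₛ a b (timesLinearₛ a′ b′ (coeffₛ (d ∷ c ∷ e ∷ [])))

coeff-split : ∀ {f₁ f₂ f₃ a b a′ b′ d c e} →
  f₁ ≈ a ∷ b ∷ [] → f₂ ≈ a′ ∷ b′ ∷ [] → f₃ ≈ d ∷ c ∷ e ∷ [] →
  ∀ n → coeff (foldr _*ᴾ_ (C 1ℚ) (f₁ ∷ f₂ ∷ f₃ ∷ [])) n ≡ splitCoeffs a b a′ b′ d c e n
coeff-split {f₃ = f₃} {a} {b} {a′} {b′} {d} {c} {e} e₁ e₂ e₃ n =
  trans (coeff-≡ (*ᴾ-cong e₁ (*ᴾ-cong e₂ (≈-trans (*ᴾ-identityʳ f₃) e₃))) n)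
        (coeff-linear²-*ᴾ a b a′ b′ (d ∷ c ∷ e ∷ []) n)

monicSplitₛ : ∀ {k} → Polynomial k → Polynomial k → ℕ → Polynomial k
monicSplitₛ t u = splitCoeffsₛ (:- t) (con 1ℚ) (:- (t :* u)) (con 1ℚ)
  (t :* t :* (u :* u :+ u :+ con 1ℚ)) (t :* (u :+ con 1ℚ)) (con 1ℚ)

-- The parametrized family, with roots t and tu

module _ (t u : ℚ) where

  linearCoeff constantCoeff cofactor₀ cofactor₁ : ℚ
  linearCoeff   = - (u + 1ℚ) * (u ^ 2 + 1ℚ) * t ^ 3
  constantCoeff = u * (u ^ 2 + u + 1ℚ) * t ^ 4
  cofactor₀     = t * t * (u * u + u + 1ℚ)
  cofactor₁     = t * (u + 1ℚ)

  cofactor-irreducible : t ≢ 0ℚ → Irreducible (cofactor₀ ∷ cofactor₁ ∷ 1ℚ ∷ [])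
  cofactor-irreducible t≢0 = quadratic-irreducible (HasDegree-quadratic λ ()) λ w eq →
    -- If w² is the discriminant -(2t² + 2(tu)² + v²), where v is `cofactor₁`, then t² + w² + (tu)²
    -- + (tu)² + t² + v² = 0, which forces t = 0.
    t≢0 (sumOfSquares≡0 t (w ∷ t * u ∷ t * u ∷ t ∷ cofactor₁ ∷ [])
      (trans (cong (λ z → t * t + (z + sumOfSquares (t * u ∷ t * u ∷ t ∷ cofactor₁ ∷ []))) eq)
             (identity t u)))
    where
    identity : ∀ t u → let v = t * (u + 1ℚ) in
      t * t + ((v * v + - (4ℚ * (t * t * (u * u + u + 1ℚ) * 1ℚ)))
        + sumOfSquares (t * u ∷ t * u ∷ t ∷ v ∷ [])) ≡ 0ℚ
    identity = solve 2 (λ t u → let v = t :* (u :+ con 1ℚ) in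
      t :* t :+ ((v :* v :+ :- (con 4ℚ :* (t :* t :* (u :* u :+ u :+ con 1ℚ) :* con 1ℚ)))
        :+ (t :* u :* (t :* u) :+ (t :* u :* (t :* u) :+ (t :* t :+ (v :* v :+ con 0ℚ))))) := con 0ℚ) refl

  trinomial-split : ∀ n → coeff (constantCoeff ∷ linearCoeff ∷ 0ℚ ∷ 0ℚ ∷ 1ℚ ∷ []) n ≡
                    splitCoeffs (- t) 1ℚ (- (t * u)) 1ℚ cofactor₀ cofactor₁ 1ℚ n
  trinomial-split 0 = solve 2 (λ t u →
      -- Powers are written as `_^_` unfolds them, as right-nested products ending in `1ℚ`.
      u :* (u :* (u :* con 1ℚ) :+ u :+ con 1ℚ) :* (t :* (t :* (t :* (t :* con 1ℚ)))) := monicSplitₛ t u 0) refl t u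
  trinomial-split 1 = solve 2 (λ t u →
      :- (u :+ con 1ℚ) :* (u :* (u :* con 1ℚ) :+ con 1ℚ) :* (t :* (t :* (t :* con 1ℚ))) := monicSplitₛ t u 1) refl t u
  trinomial-split 2 = solve 2 (λ t u → con 0ℚ := monicSplitₛ t u 2) refl t u
  trinomial-split 3 = solve 2 (λ t u → con 0ℚ := monicSplitₛ t u 3) refl t u
  trinomial-split 4 = solve 2 (λ t u → con 1ℚ := monicSplitₛ t u 4) refl t u
  -- From index 5 on all coefficients unfold to the same expression, so the identity at 5 serves for
  -- each.
  trinomial-split (suc (suc (suc (suc (suc _))))) = solve 2 (λ t u → con 0ℚ := monicSplitₛ t u 5) refl t u

  -- The factors are given only up to `_≈_`, so that both explicit coefficient lists and polynomials
  -- written with `X` can be supplied.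
  split-factorization : ∀ {A B f₁ f₂ f₃} → t ≢ 0ℚ → A ≡ linearCoeff → B ≡ constantCoeff →
    f₁ ≈ - t ∷ 1ℚ ∷ [] → f₂ ≈ - (t * u) ∷ 1ℚ ∷ [] → f₃ ≈ cofactor₀ ∷ cofactor₁ ∷ 1ℚ ∷ [] →
    IrreducibleFactorization (trinomial 4 1 A B) (f₁ ∷ f₂ ∷ f₃ ∷ [])
  split-factorization t≢0 refl refl e₁ e₂ e₃ = record
    { irreducible = linear-irreducible (HasDegree-resp-≈ (≈-sym e₁) (HasDegree-linear λ ()))
                  ∷ linear-irreducible (HasDegree-resp-≈ (≈-sym e₂) (HasDegree-linear λ ()))
                  ∷ Irreducible-resp-≈ (≈-sym e₃) (cofactor-irreducible t≢0)
                  ∷ []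
    ; factors = ≈-trans (trinomial-coeffs linearCoeff constantCoeff)
        (mk≈ λ n → trans (trinomial-split n) (sym (coeff-split e₁ e₂ e₃ n)))
    }

parametrized⇒type-112 : ∀ {A B} u →
  UpToScaling 4 1 (A , B) (- (u + 1ℚ) * (u ^ 2 + 1ℚ) , u * (u ^ 2 + u + 1ℚ)) →
  HasReducibilityType (trinomial 4 1 A B) (1 ∷ 1 ∷ 2 ∷ [])
parametrized⇒type-112 {A} {B} u (t , t≢0 , A≡ , B≡) = record
  { monic         = trinomial-monic A B
  ; sorted        = s≤s z≤n ∷ s≤s z≤n ∷ [-]
  ; fs            = (- t ∷ 1ℚ ∷ []) ∷ (- (t * u) ∷ 1ℚ ∷ []) ∷ (cofactor₀ t u ∷ cofactor₁ t u ∷ 1ℚ ∷ []) ∷ []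
  ; factorization = split-factorization t u t≢0 A≡ B≡ ≈-refl ≈-refl ≈-refl
  ; degrees       = HasDegree-linear (λ ()) ∷ HasDegree-linear (λ ()) ∷ HasDegree-quadratic (λ ()) ∷ []
  }

factorization-at-scale-1 : ∀ u →
  IrreducibleFactorization
    (trinomial 4 1 (- (u + 1ℚ) * (u ^ 2 + 1ℚ)) (u * (u ^ 2 + u + 1ℚ)))
    ( (X -ᴾ C 1ℚ)
    ∷ (X -ᴾ C u)
    ∷ (X ^ᴾ 2 +ᴾ C (u + 1ℚ) *ᴾ X +ᴾ C (u ^ 2 + u + 1ℚ))
    ∷ [])
factorization-at-scale-1 u =
  -- At scale t = 1 the powers of t compute to `1ℚ`.
  split-factorization 1ℚ u (λ ()) (sym (*-identityʳ (- (u + 1ℚ) * (u ^ 2 + 1ℚ))))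
    (sym (*-identityʳ (u * (u ^ 2 + u + 1ℚ)))) ≈-refl
    (mk≈ λ { 0 → solve 1 (λ u → con 0ℚ :+ :- u := :- (con 1ℚ :* u)) refl u
           ; 1 → refl ; (suc (suc _)) → refl })
    (mk≈ λ { 0 → solve 1 (λ u →
                   (con 0ℚ :+ ((u :+ con 1ℚ) :* con 0ℚ :+ con 0ℚ)) :+ (u :* (u :* con 1ℚ) :+ u :+ con 1ℚ) :=
                   con 1ℚ :* con 1ℚ :* (u :* u :+ u :+ con 1ℚ)) refl u
           ; 1 → solve 1 (λ u → con 0ℚ :+ (u :+ con 1ℚ) :* con 1ℚ := con 1ℚ :* (u :+ con 1ℚ)) refl u
           ; 2 → refl ; (suc (suc (suc _))) → refl })

-- Type (1,1,2) implies the parametrization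

-- The leading coefficients multiply to k = b b′ e = 1; each identity below is
-- made homogeneous by inserting powers of k before it is read in terms of the
-- roots r, s and the monic quadratic factor x² + c′x + d′.
vieta-split : ∀ a b a′ b′ d c e A B →
  (∀ n → coeff (B ∷ A ∷ 0ℚ ∷ 0ℚ ∷ 1ℚ ∷ []) n ≡ splitCoeffs a b a′ b′ d c e n) →
  ∃[ r ] ∃[ s ] (A ≡ - (r + s) * (r * r + s * s) × B ≡ r * s * (r * r + r * s + s * s))
vieta-split a b a′ b′ d c e A B h = r , s , A≡ , B≡
  where
  -- As b b′ e = 1, the inverse of b is b′e, so this is the root -a/b; likewise s = -a′/b′, c′ = c/e
  -- and d′ = d/e.
  r = - (a * b′ * e)
  s = - (a′ * b * e)
  c′ = b * b′ * c
  d′ = b * b′ * d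
  1≡k : 1ℚ ≡ b * b′ * e
  1≡k = trans (h 4)
    (solve 7 (λ a b a′ b′ d c e → splitCoeffsₛ a b a′ b′ d c e 4 := b :* b′ :* e) refl a b a′ b′ d c e)
  c′≡ : c′ ≡ r + s
  -- The coefficient of x³ is c′ - (r + s), and it is zero.
  c′≡ = trans
    (solve 7 (λ a b a′ b′ d c e → b :* b′ :* c :=
       splitCoeffsₛ a b a′ b′ d c e 3 :+ (:- (a :* b′ :* e) :+ :- (a′ :* b :* e))) refl a b a′ b′ d c e)
    (trans (cong (_+ (r + s)) (sym (h 3))) (+-identityˡ (r + s)))
  d′≡ : d′ ≡ (r + s) * (r + s) + - (r * s)
  -- The vanishing coefficient of x² gives d′ = (r + s)c′ - rs; the factor `con 1ℚ` is the place
  -- where k is inserted.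
  d′≡ = trans
    (solve 7 (λ a b a′ b′ d c e → b :* b′ :* d :=
       splitCoeffsₛ a b a′ b′ d c e 2 :+ :- (con 1ℚ :* (a :* a′ :* e :+ (a :* b′ :+ a′ :* b) :* c))) refl a b a′ b′ d c e)
    (trans (cong₂ (λ y k → y + - (k * (a * a′ * e + (a * b′ + a′ * b) * c))) (sym (h 2)) 1≡k)
    (trans
    (solve 7 (λ a b a′ b′ d c e → let r = :- (a :* b′ :* e); s = :- (a′ :* b :* e) in
       con 0ℚ :+ :- (b :* b′ :* e :* (a :* a′ :* e :+ (a :* b′ :+ a′ :* b) :* c)) :=
       (r :+ s) :* (b :* b′ :* c) :+ :- (r :* s)) refl a b a′ b′ d c e)
    (cong (λ y → (r + s) * y + - (r * s)) c′≡)))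
  A≡ : A ≡ - (r + s) * (r * r + s * s)
  -- Here A = rs c′ - (r + s)d′, after which c′ and d′ are eliminated.
  A≡ = trans (h 1) (trans
    (solve 7 (λ a b a′ b′ d c e → splitCoeffsₛ a b a′ b′ d c e 1 :=
       con 1ℚ :* (con 1ℚ :* (a :* a′ :* c) :+ (a :* b′ :+ a′ :* b) :* d)) refl a b a′ b′ d c e)
    (trans (cong (λ k → k * (k * (a * a′ * c) + (a * b′ + a′ * b) * d)) 1≡k)
    (trans
    (solve 7 (λ a b a′ b′ d c e → let r = :- (a :* b′ :* e); s = :- (a′ :* b :* e); k = b :* b′ :* e in
       k :* (k :* (a :* a′ :* c) :+ (a :* b′ :+ a′ :* b) :* d) :=
       r :* s :* (b :* b′ :* c) :+ :- ((r :+ s) :* (b :* b′ :* d))) refl a b a′ b′ d c e)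
    (trans (cong₂ (λ y z → r * s * y + - ((r + s) * z)) c′≡ d′≡)
    (solve 2 (λ r s → r :* s :* (r :+ s) :+ :- ((r :+ s) :* ((r :+ s) :* (r :+ s) :+ :- (r :* s))) :=
       :- (r :+ s) :* (r :* r :+ s :* s)) refl r s)))))
  B≡ : B ≡ r * s * (r * r + r * s + s * s)
  B≡ = trans (h 0) (trans
    (solve 3 (λ a a′ d → a :* (a′ :* d) := con 1ℚ :* con 1ℚ :* (a :* a′ :* d)) refl a a′ d)
    (trans (cong (λ k → k * k * (a * a′ * d)) 1≡k)
    (trans
    (solve 7 (λ a b a′ b′ d c e → let r = :- (a :* b′ :* e); s = :- (a′ :* b :* e); k = b :* b′ :* e in
       k :* k :* (a :* a′ :* d) := r :* s :* (b :* b′ :* d)) refl a b a′ b′ d c e)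
    (trans (cong (r * s *_) d′≡)
    (solve 2 (λ r s → r :* s :* ((r :+ s) :* (r :+ s) :+ :- (r :* s)) :=
       r :* s :* (r :* r :+ r :* s :+ s :* s)) refl r s)))))

-- Since rs divides B, both roots are nonzero and s/r is a nonzero rational; u = -1 would mean r + s
-- = 0 and hence A = 0.
parametrize : ∀ {A B} r s → A ≢ 0ℚ → B ≢ 0ℚ →
  A ≡ - (r + s) * (r * r + s * s) → B ≡ r * s * (r * r + r * s + s * s) →
  ∃[ u ] (u ≢ 0ℚ × u ≢ - 1ℚ ×
    UpToScaling 4 1 (A , B) (- (u + 1ℚ) * (u ^ 2 + 1ℚ) , u * (u ^ 2 + u + 1ℚ)))
parametrize {A} {B} r s A≢0 B≢0 A≡ B≡ = u , u≢0 , u≢-1 , r , r≢0 , A≡scaled , B≡scaled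
  where
  rs≢0 : r * s ≢ 0ℚ
  rs≢0 = *-≢0⇒ˡ (r * s) _ (subst (_≢ 0ℚ) B≡ B≢0)
  r≢0 : r ≢ 0ℚ
  r≢0 = *-≢0⇒ˡ r s rs≢0
  instance _ = ≢-nonZero r≢0
  u = s * 1/ r
  s≡u*r : s ≡ u * r
  s≡u*r = trans (sym (*-identityʳ s)) (trans (cong (s *_) (sym (*-inverseˡ r))) (sym (*-assoc s (1/ r) r)))
  A≡scaled : A ≡ - (u + 1ℚ) * (u ^ 2 + 1ℚ) * r ^ 3
  A≡scaled = trans A≡ (trans (cong (λ s → - (r + s) * (r * r + s * s)) s≡u*r)
    (solve 2 (λ r u → :- (r :+ u :* r) :* (r :* r :+ u :* r :* (u :* r)) :=
      :- (u :+ con 1ℚ) :* (u :* (u :* con 1ℚ) :+ con 1ℚ) :* (r :* (r :* (r :* con 1ℚ)))) refl r u))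
  B≡scaled : B ≡ u * (u ^ 2 + u + 1ℚ) * r ^ 4
  B≡scaled = trans B≡ (trans (cong (λ s → r * s * (r * r + r * s + s * s)) s≡u*r)
    (solve 2 (λ r u → r :* (u :* r) :* (r :* r :+ r :* (u :* r) :+ u :* r :* (u :* r)) :=
      u :* (u :* (u :* con 1ℚ) :+ u :+ con 1ℚ) :* (r :* (r :* (r :* (r :* con 1ℚ))))) refl r u))
  u≢0 : u ≢ 0ℚ
  u≢0 = *-≢0⇒ˡ u r (subst (_≢ 0ℚ) s≡u*r (*-≢0⇒ʳ r s rs≢0))
  u≢-1 : u ≢ - 1ℚ
  u≢-1 u≡-1 = A≢0 (trans A≡scaled
    -- At u = -1 the factor in front of `r ^ 3` is closed and computes to `0ℚ`.
    (trans (cong (λ u → - (u + 1ℚ) * (u ^ 2 + 1ℚ) * r ^ 3) u≡-1) (*-zeroˡ (r ^ 3))))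

type-112⇒parametrized : ∀ {A B} → A * B ≢ 0ℚ →
  HasReducibilityType (trinomial 4 1 A B) (1 ∷ 1 ∷ 2 ∷ []) →
  ∃[ u ] (u ≢ 0ℚ × u ≢ - 1ℚ ×
    UpToScaling 4 1 (A , B) (- (u + 1ℚ) * (u ^ 2 + 1ℚ) , u * (u ^ 2 + u + 1ℚ)))
type-112⇒parametrized {A} {B} AB≢0 record
  { fs = f₁ ∷ f₂ ∷ f₃ ∷ [] ; factorization = fac ; degrees = d₁ ∷ d₂ ∷ d₃ ∷ [] } =
  -- The factors need not be monic; their degrees turn them into lists of two, two and three
  -- coefficients, which fill the underscores.
  let r , s , A≡ , B≡ = vieta-split _ _ _ _ _ _ _ A B λ n →
        trans (coeff-≡ (≈-trans (≈-sym (trinomial-coeffs A B)) (IrreducibleFactorization.factors fac)) n)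
              (coeff-split (applyUpTo-coeff f₁ d₁) (applyUpTo-coeff f₂ d₂) (applyUpTo-coeff f₃ d₃) n)
  in parametrize r s (*-≢0⇒ˡ A B AB≢0) (*-≢0⇒ʳ A B AB≢0) A≡ B≡

-- Exclusion of type (1,1,1,1)

linearCoeffs : (a₁ b₁ a₂ b₂ a₃ b₃ a₄ b₄ : ℚ) → ℕ → ℚ
linearCoeffs a₁ b₁ a₂ b₂ a₃ b₃ a₄ b₄ =
  timesLinear a₁ b₁ (timesLinear a₂ b₂ (timesLinear a₃ b₃ (coeff (a₄ ∷ b₄ ∷ []))))

linearCoeffsₛ : ∀ {k} (a₁ b₁ a₂ b₂ a₃ b₃ a₄ b₄ : Polynomial k) → ℕ → Polynomial k
linearCoeffsₛ a₁ b₁ a₂ b₂ a₃ b₃ a₄ b₄ =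
  timesLinearₛ a₁ b₁ (timesLinearₛ a₂ b₂ (timesLinearₛ a₃ b₃ (coeffₛ (a₄ ∷ b₄ ∷ []))))

-- With rᵢ = aᵢ ∏_{j≠i} bⱼ (up to sign a root, as ∏ bⱼ = 1), Σ rᵢ is the
-- coefficient of x³ and Σ rᵢ² = (Σ rᵢ)² - 2 (∏ bⱼ) e₂ with e₂ that of x².
vieta-linear : ∀ a₁ b₁ a₂ b₂ a₃ b₃ a₄ b₄ A B →
  (∀ n → coeff (B ∷ A ∷ 0ℚ ∷ 0ℚ ∷ 1ℚ ∷ []) n ≡ linearCoeffs a₁ b₁ a₂ b₂ a₃ b₃ a₄ b₄ n) →
  B ≡ 0ℚ
vieta-linear a₁ b₁ a₂ b₂ a₃ b₃ a₄ b₄ A B h =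
  trans (h 0) (trans (cong (_* (a₂ * (a₃ * a₄))) a₁≡0) (*-zeroˡ (a₂ * (a₃ * a₄))))
  where
  r₁ = a₁ * (b₂ * b₃ * b₄)
  r₂ = a₂ * (b₁ * b₃ * b₄)
  r₃ = a₃ * (b₁ * b₂ * b₄)
  r₄ = a₄ * (b₁ * b₂ * b₃)
  r₁≡0 : r₁ ≡ 0ℚ
  r₁≡0 = sumOfSquares≡0 r₁ (r₂ ∷ r₃ ∷ r₄ ∷ []) (trans
    (solve 8 (λ a₁ b₁ a₂ b₂ a₃ b₃ a₄ b₄ →
      let r₁ = a₁ :* (b₂ :* b₃ :* b₄) ; r₂ = a₂ :* (b₁ :* b₃ :* b₄)
          r₃ = a₃ :* (b₁ :* b₂ :* b₄) ; r₄ = a₄ :* (b₁ :* b₂ :* b₃)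
          e = linearCoeffsₛ a₁ b₁ a₂ b₂ a₃ b₃ a₄ b₄ in
      r₁ :* r₁ :+ (r₂ :* r₂ :+ (r₃ :* r₃ :+ (r₄ :* r₄ :+ con 0ℚ))) :=
      e 3 :* e 3 :+ :- ((con 1ℚ :+ con 1ℚ) :* (b₁ :* b₂ :* b₃ :* b₄)) :* e 2)
      refl a₁ b₁ a₂ b₂ a₃ b₃ a₄ b₄)
    (trans (cong₂ (λ y z → y * y + m * z) (sym (h 3)) (sym (h 2)))
           (trans (+-identityˡ (m * 0ℚ)) (*-zeroʳ m))))
    where m = - ((1ℚ + 1ℚ) * (b₁ * b₂ * b₃ * b₄))
  a₁≡0 : a₁ ≡ 0ℚ
  -- Multiplication by ∏ bⱼ = 1 turns a₁ into b₁r₁.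
  a₁≡0 = trans (sym (*-identityʳ a₁)) (trans (cong (a₁ *_) (h 4)) (trans
    (solve 8 (λ a₁ b₁ a₂ b₂ a₃ b₃ a₄ b₄ →
      a₁ :* linearCoeffsₛ a₁ b₁ a₂ b₂ a₃ b₃ a₄ b₄ 4 := b₁ :* (a₁ :* (b₂ :* b₃ :* b₄)))
      refl a₁ b₁ a₂ b₂ a₃ b₃ a₄ b₄)
    (x*0≡0 b₁ r₁≡0)))

coeff-linears : ∀ {f₁ f₂ f₃ f₄ a₁ b₁ a₂ b₂ a₃ b₃ a₄ b₄} →
  f₁ ≈ a₁ ∷ b₁ ∷ [] → f₂ ≈ a₂ ∷ b₂ ∷ [] → f₃ ≈ a₃ ∷ b₃ ∷ [] → f₄ ≈ a₄ ∷ b₄ ∷ [] →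
  ∀ n → coeff (foldr _*ᴾ_ (C 1ℚ) (f₁ ∷ f₂ ∷ f₃ ∷ f₄ ∷ [])) n ≡ linearCoeffs a₁ b₁ a₂ b₂ a₃ b₃ a₄ b₄ n
coeff-linears {f₄ = f₄} {a₁} {b₁} {a₂} {b₂} {a₃} {b₃} {a₄} {b₄} p₁ p₂ p₃ p₄ n =
  trans (coeff-≡ (*ᴾ-cong p₁ (*ᴾ-cong p₂ (*ᴾ-cong p₃ (≈-trans (*ᴾ-identityʳ f₄) p₄)))) n)
  (trans (coeff-linear²-*ᴾ a₁ b₁ a₂ b₂ ((a₃ ∷ b₃ ∷ []) *ᴾ (a₄ ∷ b₄ ∷ [])) n)
         (timesLinear-cong a₁ b₁ (timesLinear-cong a₂ b₂ (coeff-linear-*ᴾ a₃ b₃ (a₄ ∷ b₄ ∷ []))) n))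

¬type-1111 : ∀ A {B} → B ≢ 0ℚ → ¬ HasReducibilityType (trinomial 4 1 A B) (1 ∷ 1 ∷ 1 ∷ 1 ∷ [])
¬type-1111 A {B} B≢0 record
  { fs = f₁ ∷ f₂ ∷ f₃ ∷ f₄ ∷ [] ; factorization = fac ; degrees = d₁ ∷ d₂ ∷ d₃ ∷ d₄ ∷ [] } =
  B≢0 (vieta-linear _ _ _ _ _ _ _ _ A B λ n →
    trans (coeff-≡ (≈-trans (≈-sym (trinomial-coeffs A B)) (IrreducibleFactorization.factors fac)) n)
          (coeff-linears (applyUpTo-coeff f₁ d₁) (applyUpTo-coeff f₂ d₂)
                         (applyUpTo-coeff f₃ d₃) (applyUpTo-coeff f₄ d₄) n))

theorem2p1 : (∀ (A B : ℚ) → A * B ≢ 0ℚ →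
    HasReducibilityType (trinomial 4 1 A B) (1 ∷ 1 ∷ 2 ∷ [])
    ⇔
    (∃[ u ] (u ≢ 0ℚ × u ≢ - 1ℚ ×
    UpToScaling 4 1 (A , B) (- (u + 1ℚ) * (u ^ 2 + 1ℚ) , u * (u ^ 2 + u + 1ℚ)))))
    ×
    (∀ (u : ℚ) → u ≢ 0ℚ → u ≢ - 1ℚ →
    IrreducibleFactorization
    (trinomial 4 1 (- (u + 1ℚ) * (u ^ 2 + 1ℚ)) (u * (u ^ 2 + u + 1ℚ)))
    ( (X -ᴾ C 1ℚ)
    ∷ (X -ᴾ C u)
    ∷ (X ^ᴾ 2 +ᴾ C (u + 1ℚ) *ᴾ X +ᴾ C (u ^ 2 + u + 1ℚ))
    ∷ []))
    ×
    (∀ (A B : ℚ) → A * B ≢ 0ℚ →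
    ¬ HasReducibilityType (trinomial 4 1 A B) (1 ∷ 1 ∷ 1 ∷ 1 ∷ []))
theorem2p1 =
  (λ A B AB≢0 → mk⇔ (type-112⇒parametrized AB≢0)
                     (λ (u , _ , _ , scaling) → parametrized⇒type-112 u scaling)) ,
  (λ u _ _ → factorization-at-scale-1 u) ,
  (λ A B AB≢0 → ¬type-1111 A (*-≢0⇒ʳ A B AB≢0))
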